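{- For all integers $n\geq 2$ and $k\geq 0$, $$2nJ_{2n,k}=[k(k+1)+2n-2]J_{2n-2,k}+2[(k-1)(2n-k-1)+1]J_{2n-2,k-1}+[(2n-k)(2n-k+1)+2n-2]J_{2n-2,k-2},$$ where $J_{m,j}=0$ for $j<0$.
   Context: For a permutation $\pi=a_1a_2\cdots a_m$ of $[m]=\{1,\ldots,m\}$, a descent is an index $1\leq i\leq m-1$ with $a_i>a_{i+1}$, and ${\rm d}(\pi)$ is the number of descents. A fixed-point free involution of $[m]$ is a permutation $\pi$ with $\pi^2=\mathrm{id}$ and $\pi(i)\neq i$ for all $i$. $J_{m,j}$ denotes the number of fixed-point free involutions of $[m]$ with exactly $j$ descents (so $J_{m,j}=0$ for $j<0$ or $j>m-1$). -}

module Defs where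

open import Algebra.Definitions using (Involutive)
open import Data.Fin.Base using (Fin; inject₁; suc; _>_)
open import Data.Fin.Properties using (_≟_; _<?_; all?)
open import Data.Integer.Base using (ℤ; +_)
import Data.Integer.Properties as ℤ
open import Data.List.Base as List using (List; allFin; cartesianProductWith; filter; length)
open import Data.Nat.Base using (ℕ; zero; suc)
open import Data.Product.Base using (_×_)
open import Data.Vec.Base using (Vec; []; _∷_; lookup)
open import Data.Vec.Relation.Unary.AllPairs using (allPairs?)
open import Data.Vec.Relation.Unary.Unique.Propositional using (Unique)
open import Relation.Binary.PropositionalEquality.Core using (_≡_; _≢_)
open import Relation.Nullary.Decidable using (¬?; _×-dec_)
open import Relation.Unary using (Decidable)

-- A permutation a₁a₂⋯aₘ of [m] is given in one-line notation, as a duplicate-free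
-- word of length m over Fin m; the letter i of Fin m stands for toℕ i + 1.

Word : ℕ → Set
Word m = Vec (Fin m) m

IsPermutation : ∀ {m} → Word m → Set
IsPermutation π = Unique π

isPermutation? : ∀ {m} → Decidable (IsPermutation {m})
isPermutation? π = allPairs? (λ a b → ¬? (a ≟ b)) π

FixedPointFree : ∀ {m} → Word m → Set
FixedPointFree π = ∀ i → lookup π i ≢ i

IsFPFInvolution : ∀ {m} → Word m → Set
IsFPFInvolution π = IsPermutation π × Involutive _≡_ (lookup π) × FixedPointFree π

isFPFInvolution? : ∀ {m} → Decidable (IsFPFInvolution {m})
isFPFInvolution? π =
  isPermutation? π
    ×-dec all? (λ i → lookup π (lookup π i) ≟ i)
    ×-dec all? (λ i → ¬? (lookup π i ≟ i))

-- inject₁ i and suc i are the adjacent positions i and i + 1 of a word of length suc ℓ.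

IsDescent : ∀ {k ℓ} → Vec (Fin k) (suc ℓ) → Fin ℓ → Set
IsDescent w i = lookup w (inject₁ i) > lookup w (suc i)

isDescent? : ∀ {k ℓ} (w : Vec (Fin k) (suc ℓ)) → Decidable (IsDescent w)
isDescent? w i = lookup w (suc i) <? lookup w (inject₁ i)

descents : ∀ {k ℓ} → Vec (Fin k) ℓ → ℕ
descents {ℓ = zero}  w = 0
descents {ℓ = suc ℓ} w = length (filter (isDescent? w) (allFin ℓ))

-- Every vector of length ℓ over Fin k, each listed exactly once.

allVecs : ∀ k ℓ → List (Vec (Fin k) ℓ)
allVecs k zero    = List.[ [] ]
allVecs k (suc ℓ) = cartesianProductWith _∷_ (allFin k) (allVecs k ℓ)

fpfInvolutions : ∀ m → List (Word m)
fpfInvolutions m = filter isFPFInvolution? (allVecs m m)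

-- The second index is an integer, so that J m j is also defined, and zero, for j < 0.

J : ℕ → ℤ → ℕ
J m j = length (filter (λ π → (+ descents π) ℤ.≟ j) (fpfInvolutions m))

{-# OPTIONS --safe #-}

-- Deleting an ordered 2-cycle (a b) from a fixed-point free involution of [m + 2] is a bijection
-- onto the triples (σ, a, b) with σ a fixed-point free involution of [m]. So it suffices to
-- count, for a fixed σ with d descents, the insertions of an ordered 2-cycle that create 0, 1 or 2
-- descents; these numbers turn out to depend on d only. Put e = 0 σ₁ ⋯ σₘ (m + 1). Inserting one
-- letter at position gap p and value gap q (0 ≤ p, q ≤ m) creates 1 − ε(p,q) descents, where
--   ε(p,q) = [e_p ≤ q] − [e_{p+1} ≤ q] + [e_{p+1} < e_p],
-- and inserting a 2-cycle at the gaps p ≠ q creates 2 − ε(p,q) − ε(q,p) descents, while at p = q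
-- it creates 2 − ε(p,p). The counts are therefore determined by the sums of ε(p,q), ε(p,q)ε(q,p)
-- and ε(p,p), which telescope because e is an involution fixing only 0 and m + 1.

module Submission where

open import Defs
open import Data.Nat.Base as ℕ using (ℕ)
open import Data.Integer.Base using (ℤ; +_; _+_; _-_; _*_)
open import Relation.Binary.PropositionalEquality.Core using (_≡_)

open import Algebra.Definitions using (Involutive)
open import Data.Fin.Base using (Fin; zero; suc; toℕ; fromℕ; inject₁; pinch; punchIn; punchOut)
open import Data.Fin.Properties
  using (_≟_; _<?_; toℕ-inject₁; toℕ-fromℕ; toℕ<n; toℕ-injective; suc-injective; inject₁-injective;
         punchIn-injective; punchInᵢ≢i; punchIn-punchOut)
open import Data.Fin.Relation.Unary.Top using (view; ‵fromℕ; ‵inject₁)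
open import Data.Integer.Base using (0ℤ; 1ℤ)
import Data.Integer.Properties as ℤ
open import Data.Integer.Tactic.RingSolver using (solve-∀)
open import Data.List.Base as List using (List; allFin; cartesianProduct; filter; length)
open import Data.List.Membership.Propositional using (_∈_)
open import Data.List.Membership.Propositional.Properties
  using (∈-allFin; ∈-cartesianProduct⁺; ∈-cartesianProduct⁻; ∈-cartesianProductWith⁺;
         ∈-filter⁺; ∈-filter⁻; ∈-map⁺; ∈-map⁻)
open import Data.List.Membership.Propositional.Properties.WithK using (unique∧set⇒bag)
open import Data.List.Relation.Binary.BagAndSetEquality using (∼bag⇒↭)
open import Data.List.Relation.Binary.Permutation.Propositional using (_↭_; ↭⇒↭ₛ)
import Data.List.Relation.Binary.Permutation.Propositional.Properties as ↭
open import Data.List.Relation.Binary.Permutation.Setoid.Properties ℤ.≡-setoid using (foldr-commMonoid)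
import Data.List.Relation.Unary.All as All
import Data.List.Relation.Unary.AllPairs as AllPairs
open import Data.List.Relation.Unary.Any using (here; there)
open import Data.List.Relation.Unary.Unique.Propositional using (Unique)
import Data.List.Relation.Unary.Unique.Propositional.Properties as Unique
open import Data.Nat.Base using (zero; suc)
open import Data.Product.Base using (_×_; _,_; ∃; proj₁; proj₂)
open import Data.Sum.Base using (_⊎_; inj₁; inj₂)
open import Data.Unit.Base using (⊤; tt)
open import Data.Vec.Base using (Vec; []; _∷_; _∷ʳ_; insertAt; lookup; map; tabulate)
open import Data.Vec.Properties
  using (lookup-map; insertAt-lookup; insertAt-punchIn; lookup∘tabulate; tabulate∘lookup;
         tabulate-cong; ∷-injective)
import Data.Vec.Relation.Unary.Unique.Propositional.Properties as VecUnique
open import Function.Base using (_∘_; id)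
open import Function.Bundles using (mk⇔)
open import Relation.Binary.PropositionalEquality hiding (J)
open import Relation.Nullary using (Dec; yes; no; ¬_; contradiction)
open import Relation.Unary using (Decidable)
open import Algebra.Properties.Semiring.Sum ℤ.+-*-semiring
  using (sum; sum-cong-≗; ∑-distrib-+; ∑-comm; sum-init-last; *-distribˡ-sum; *-distribʳ-sum)

-- Finite sums

sumOver : ∀ {a} {A : Set a} → (A → ℤ) → List A → ℤ
sumOver f xs = List.foldr _+_ 0ℤ (List.map f xs)

sumOver-map : ∀ {a b} {A : Set a} {B : Set b} (f : A → ℤ) (g : B → A) xs →
  sumOver f (List.map g xs) ≡ sumOver (f ∘ g) xs
sumOver-map f g List.[]       = refl
sumOver-map f g (x List.∷ xs) = cong₂ _+_ (refl {x = f (g x)}) (sumOver-map f g xs)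

module _ {a} {A : Set a} where

  sumOver-++ : ∀ (f : A → ℤ) xs ys → sumOver f (xs List.++ ys) ≡ sumOver f xs + sumOver f ys
  sumOver-++ f List.[]       ys = sym (ℤ.+-identityˡ (sumOver f ys))
  sumOver-++ f (x List.∷ xs) ys = trans (cong₂ _+_ (refl {x = f x}) (sumOver-++ f xs ys)) (sym (ℤ.+-assoc (f x) _ _))

  sumOver-cong-∈ : ∀ {f g : A → ℤ} xs → (∀ {x} → x ∈ xs → f x ≡ g x) → sumOver f xs ≡ sumOver g xs
  sumOver-cong-∈ List.[]       f≗g = refl
  sumOver-cong-∈ (x List.∷ xs) f≗g = cong₂ _+_ (f≗g (here refl)) (sumOver-cong-∈ xs (f≗g ∘ there))

  sumOver-↭ : ∀ (f : A → ℤ) {xs ys} → xs ↭ ys → sumOver f xs ≡ sumOver f ys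
  sumOver-↭ f xs↭ys = foldr-commMonoid ℤ.+-0-isCommutativeMonoid (↭⇒↭ₛ (↭.map⁺ f xs↭ys))

  sumOver-tabulate : ∀ (f : A → ℤ) {n} (g : Fin n → A) → sumOver f (List.tabulate g) ≡ sum (f ∘ g)
  sumOver-tabulate f {zero}  g = refl
  sumOver-tabulate f {suc n} g = cong₂ _+_ (refl {x = f (g zero)}) (sumOver-tabulate f (g ∘ suc))

  sumOver-linear : ∀ (f g h : A → ℤ) a b c xs →
    sumOver (λ x → a * f x + b * g x + c * h x) xs ≡ a * sumOver f xs + b * sumOver g xs + c * sumOver h xs
  sumOver-linear f g h a b c List.[] = nil a b c
    where
    nil : ∀ a b c → 0ℤ ≡ a * 0ℤ + b * 0ℤ + c * 0ℤ
    nil = solve-∀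
  sumOver-linear f g h a b c (x List.∷ xs) = trans
    (cong₂ _+_ (refl {x = a * f x + b * g x + c * h x}) (sumOver-linear f g h a b c xs))
    (regroup a b c (f x) (g x) (h x) (sumOver f xs) (sumOver g xs) (sumOver h xs))
    where
    regroup : ∀ a b c x y z s t u → a * x + b * y + c * z + (a * s + b * t + c * u)
      ≡ a * (x + s) + b * (y + t) + c * (z + u)
    regroup = solve-∀

  sumOver-*ˡ : ∀ (f : A → ℤ) c xs → sumOver (λ x → c * f x) xs ≡ c * sumOver f xs
  sumOver-*ˡ f c List.[]       = sym (ℤ.*-zeroʳ c)
  sumOver-*ˡ f c (x List.∷ xs) =
    trans (cong₂ _+_ (refl {x = c * f x}) (sumOver-*ˡ f c xs)) (sym (ℤ.*-distribˡ-+ c (f x) _))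

sumOver-cartesianProduct : ∀ {a b} {A : Set a} {B : Set b} (f : A × B → ℤ) xs ys →
  sumOver f (cartesianProduct xs ys) ≡ sumOver (λ x → sumOver (λ y → f (x , y)) ys) xs
sumOver-cartesianProduct f List.[]       ys = refl
sumOver-cartesianProduct f (x List.∷ xs) ys =
  trans (sumOver-++ f (List.map (x ,_) ys) (cartesianProduct xs ys))
    (cong₂ _+_ (sumOver-map f (x ,_) ys) (sumOver-cartesianProduct f xs ys))

indicator : ∀ {p} {P : Set p} → Dec P → ℤ
indicator (yes _) = 1ℤ
indicator (no  _) = 0ℤ

length-filter : ∀ {a p} {A : Set a} {P : A → Set p} (P? : Decidable P) xs →
  + length (filter P? xs) ≡ sumOver (indicator ∘ P?) xs
length-filter P? List.[]       = refl
length-filter P? (x List.∷ xs) with P? x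
... | yes _ = cong₂ _+_ (refl {x = 1ℤ}) (length-filter P? xs)
... | no  _ = trans (length-filter P? xs) (sym (ℤ.+-identityˡ _))

-- Descents under insertion of a letter

-- The bracket [i ≤ j] as an integer. Structural recursion makes comparisons with the sentinel 0 and
-- simultaneous shifts by `suc` compute.
le : ℕ → ℕ → ℤ
le zero    _       = 1ℤ
le (suc _) zero    = 0ℤ
le (suc i) (suc j) = le i j

lt : ℕ → ℕ → ℤ
lt i j = le (suc i) j

lt≡1-le : ∀ i j → lt i j ≡ 1ℤ - le j i
lt≡1-le i       zero    = refl
lt≡1-le zero    (suc j) = refl
lt≡1-le (suc i) (suc j) = lt≡1-le i j

le-refl : ∀ i → le i i ≡ 1ℤ
le-refl zero    = refl
le-refl (suc i) = le-refl i

lt-irrefl : ∀ i → lt i i ≡ 0ℤ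
lt-irrefl zero    = refl
lt-irrefl (suc i) = lt-irrefl i

<⇒lt : ∀ {i j} → i ℕ.< j → lt i j ≡ 1ℤ
<⇒lt {zero}  (ℕ.s≤s _)   = refl
<⇒lt {suc i} (ℕ.s≤s i<j) = <⇒lt i<j

≮⇒lt : ∀ {i j} → ¬ i ℕ.< j → lt i j ≡ 0ℤ
≮⇒lt {_}     {zero}  _   = refl
≮⇒lt {zero}  {suc j} i≮j = contradiction (ℕ.s≤s ℕ.z≤n) i≮j
≮⇒lt {suc i} {suc j} i≮j = ≮⇒lt (i≮j ∘ ℕ.s≤s)

-- The brackets [i ≤ j] and [i ≤ j + 1] differ only at i = j + 1. This is how the absence of fixed
-- points enters the sum over the diagonal.
le-suc-≢ : ∀ i j → i ≢ suc j → le i j ≡ le i (suc j)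
le-suc-≢ zero          j       _   = refl
le-suc-≢ (suc zero)    zero    i≢1 = contradiction refl i≢1
le-suc-≢ (suc (suc i)) zero    _   = refl
le-suc-≢ (suc i)       (suc j) i≢j = le-suc-≢ i j (i≢j ∘ cong suc)

descFrom : ∀ {n} → ℕ → Vec ℕ n → ℤ
descFrom h []      = 0ℤ
descFrom h (x ∷ v) = lt x h + descFrom x v

-- Only the adjacent pair (l, r) is affected: it is replaced by (l, y) and (y, r). Insertion at
-- `inject₁ p` never takes place after the last letter, so r always exists.
descFrom-insertAt : ∀ {n} h (v : Vec ℕ n) (p : Fin n) y →
  let l = lookup (h ∷ v) (inject₁ p); r = lookup v p in
  descFrom h (insertAt v (inject₁ p) y) ≡ descFrom h v + (lt y l + lt r y - lt r l)
descFrom-insertAt h (x ∷ v) zero y = lemma (lt y h) (lt x y) (lt x h) (descFrom x v)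
  where
  lemma : ∀ a b c d → a + (b + d) ≡ c + d + (a + b - c)
  lemma = solve-∀
descFrom-insertAt h (x ∷ v) (suc p) y =
  trans (cong₂ _+_ (refl {x = lt x h}) (descFrom-insertAt x v p y)) (sym (ℤ.+-assoc (lt x h) _ _))

-- The increasing map that skips the value c + 1. On letters numbered from 1 it is `punchIn` at the
-- value gap c, and it fixes the sentinel 0.
bump : ℕ → ℕ → ℕ
bump _       zero    = zero
bump zero    (suc i) = suc (suc i)
bump (suc c) (suc i) = suc (bump c i)

lt-bump : ∀ c i j → lt (bump c i) (bump c j) ≡ lt i j
lt-bump c       i       zero    = refl
lt-bump zero    zero    (suc j) = refl
lt-bump zero    (suc i) (suc j) = refl
lt-bump (suc c) zero    (suc j) = refl
lt-bump (suc c) (suc i) (suc j) = lt-bump c i j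

descFrom-bump : ∀ {n} c h (v : Vec ℕ n) → descFrom (bump c h) (map (bump c) v) ≡ descFrom h v
descFrom-bump c h []      = refl
descFrom-bump c h (x ∷ v) = cong₂ _+_ (lt-bump c x h) (descFrom-bump c x v)

-- `bump` and `pinch` at the same value are adjoint, so a comparison with a raised letter becomes a
-- comparison of the original letter with a lowered gap.
le-bump-pinch : ∀ {n} (c : Fin n) i (v : Fin (suc n)) →
  le (bump (toℕ c) i) (toℕ v) ≡ le i (toℕ (pinch c v))
le-bump-pinch c       zero    v       = refl
le-bump-pinch zero    (suc i) zero    = refl
le-bump-pinch zero    (suc i) (suc v) = refl
le-bump-pinch (suc c) (suc i) zero    = refl
le-bump-pinch (suc c) (suc i) (suc v) = le-bump-pinch c i v

toℕ-punchIn : ∀ {n} (c : Fin (suc n)) (i : Fin n) →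
  suc (toℕ (punchIn c i)) ≡ bump (toℕ c) (suc (toℕ i))
toℕ-punchIn zero    i       = refl
toℕ-punchIn (suc c) zero    = refl
toℕ-punchIn (suc c) (suc i) = cong suc (toℕ-punchIn c i)

bump-top : ∀ {n} (c : Fin (suc n)) → bump (toℕ c) (suc n) ≡ suc (suc n)
bump-top         zero    = refl
bump-top {suc n} (suc c) = cong suc (bump-top c)

-- gapBit l r q is 1 if inserting a letter between l and r, at the value gap q, leaves
-- the number of descents unchanged, and 0 if it adds one.

gapBit : ℕ → ℕ → ℕ → ℤ
gapBit l r q = le l q - le r q + lt r l

lt-bump-gap : ∀ c l → lt (suc c) (bump c l) ≡ 1ℤ - le l c
lt-bump-gap c       zero    = refl
lt-bump-gap zero    (suc l) = refl
lt-bump-gap (suc c) (suc l) = lt-bump-gap c l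

le-bump-gap : ∀ c r → le (bump c r) c ≡ le r c
le-bump-gap c       zero    = refl
le-bump-gap zero    (suc r) = refl
le-bump-gap (suc c) (suc r) = le-bump-gap c r

IsBit : ℤ → Set
IsBit x = x ≡ 0ℤ ⊎ x ≡ 1ℤ

le-isBit : ∀ i j → IsBit (le i j)
le-isBit zero    j       = inj₂ refl
le-isBit (suc i) zero    = inj₁ refl
le-isBit (suc i) (suc j) = le-isBit i j

-- For l ≤ r the value is the bracket [l ≤ q < r]; for r < l it is 1 - [r ≤ q < l]. The induction
-- lowers l, r and q together until one of them is 0.
gapBit-isBit : ∀ l r q → IsBit (gapBit l r q)
gapBit-isBit zero    zero    q    = inj₁ refl
gapBit-isBit zero    (suc r) q
  = subst IsBit (sym (trans (ℤ.+-identityʳ _) (sym (lt≡1-le q (suc r))))) (le-isBit (suc q) (suc r))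
gapBit-isBit (suc l) zero    q    = subst IsBit (lemma (le (suc l) q)) (le-isBit (suc l) q)
  where
  lemma : ∀ x → x ≡ x - 1ℤ + 1ℤ
  lemma = solve-∀
gapBit-isBit (suc l) (suc r) zero = subst IsBit (sym (ℤ.+-identityˡ _)) (le-isBit (suc r) l)
gapBit-isBit (suc l) (suc r) (suc q) = gapBit-isBit l r q

-- The letters are renumbered from 1, so that 0 serves as the sentinel on the left.

sentinel : ∀ {k ℓ} → Vec (Fin k) ℓ → Vec ℕ (suc ℓ)
sentinel {k} w = map (suc ∘ toℕ) w ∷ʳ suc k

ε : ∀ {k ℓ} → Vec (Fin k) ℓ → Fin (suc ℓ) → ℕ → ℤ
ε w p q = gapBit (lookup (0 ∷ sentinel w) (inject₁ p)) (lookup (sentinel w) p) q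

insertPoint : ∀ {k ℓ} → Vec (Fin k) ℓ → Fin (suc ℓ) → Fin (suc k) → Vec (Fin (suc k)) (suc ℓ)
insertPoint w p q = insertAt (map (punchIn q) w) p q

-- In the sentinel word every gap of `w` has a letter on its right, so the gap p becomes
-- `inject₁ p`. The right sentinel k + 1 is raised to k + 2 like any other large letter.
sentinel-insertPoint : ∀ {k ℓ} (w : Vec (Fin k) ℓ) p q →
  sentinel (insertPoint w p q) ≡ insertAt (map (bump (toℕ q)) (sentinel w)) (inject₁ p) (suc (toℕ q))
sentinel-insertPoint w zero q = cong (suc (toℕ q) ∷_) (tail w)
  where
  tail : ∀ {ℓ} (w : Vec _ ℓ) → sentinel (map (punchIn q) w) ≡ map (bump (toℕ q)) (sentinel w)
  tail []      = cong (_∷ []) (sym (bump-top q))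
  tail (x ∷ w) = cong₂ _∷_ (toℕ-punchIn q x) (tail w)
sentinel-insertPoint (x ∷ w) (suc p) q = cong₂ _∷_ (toℕ-punchIn q x) (sentinel-insertPoint w p q)

-- Raising the old letters keeps all comparisons among them. The new letter c + 1 lies below its
-- left neighbour unless l ≤ c and above its right neighbour exactly when r ≤ c, while a descent
-- from l to r is lost.
descFrom-insertPoint : ∀ {k ℓ} (w : Vec (Fin k) ℓ) p q →
  descFrom 0 (sentinel (insertPoint w p q)) ≡ descFrom 0 (sentinel w) + (1ℤ - ε w p (toℕ q))
descFrom-insertPoint w p q = begin
  descFrom 0 (sentinel (insertPoint w p q))
    ≡⟨ cong (descFrom 0) (sentinel-insertPoint w p q) ⟩
  descFrom 0 (insertAt v′ (inject₁ p) (suc c))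
    ≡⟨ descFrom-insertAt 0 v′ p (suc c) ⟩
  descFrom 0 v′ + (lt (suc c) (lookup (0 ∷ v′) (inject₁ p)) + lt (lookup v′ p) (suc c)
    - lt (lookup v′ p) (lookup (0 ∷ v′) (inject₁ p)))
    ≡⟨ cong₂ (λ l r → descFrom 0 v′ + (lt (suc c) l + lt r (suc c) - lt r l))
         (lookup-map (inject₁ p) (bump c) (0 ∷ v)) (lookup-map p (bump c) v) ⟩
  descFrom 0 v′ + (lt (suc c) (bump c l) + le (bump c r) c - lt (bump c r) (bump c l))
    ≡⟨ cong₂ _+_ (descFrom-bump c 0 v)
         (cong₂ _-_ (cong₂ _+_ (lt-bump-gap c l) (le-bump-gap c r)) (lt-bump c r l)) ⟩
  descFrom 0 v + (1ℤ - le l c + le r c - lt r l)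
    ≡⟨ lemma (descFrom 0 v) (le l c) (le r c) (lt r l) ⟩
  descFrom 0 v + (1ℤ - ε w p c)
    ∎
  where
  open ≡-Reasoning
  c  = toℕ q
  v  = sentinel w
  v′ = map (bump c) v
  l  = lookup (0 ∷ v) (inject₁ p)
  r  = lookup v p
  lemma : ∀ d x y z → d + (1ℤ - x + y - z) ≡ d + (1ℤ - (x - y + z))
  lemma = solve-∀

indicator-<? : ∀ {k} (i j : Fin k) → indicator (i <? j) ≡ lt (toℕ i) (toℕ j)
indicator-<? i j with i <? j
... | yes i<j = sym (<⇒lt i<j)
... | no  i≮j = sym (≮⇒lt i≮j)

-- A leading 0 and a final letter larger than all others take part in no descent.
descents≡descFrom : ∀ {k ℓ} (w : Vec (Fin k) ℓ) → + descents w ≡ descFrom 0 (sentinel w)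
descents≡descFrom []      = refl
descents≡descFrom {k} {suc ℓ} (x ∷ w) = begin
  + length (filter (isDescent? (x ∷ w)) (allFin ℓ))
    ≡⟨ length-filter (isDescent? (x ∷ w)) (allFin ℓ) ⟩
  sumOver (indicator ∘ isDescent? (x ∷ w)) (allFin ℓ)
    ≡⟨ sumOver-tabulate (indicator ∘ isDescent? (x ∷ w)) id ⟩
  sum (indicator ∘ isDescent? (x ∷ w))
    ≡⟨ sum-cong-≗ (λ i → indicator-<? (lookup w i) (lookup (x ∷ w) (inject₁ i))) ⟩
  sum (λ i → lt (toℕ (lookup w i)) (toℕ (lookup (x ∷ w) (inject₁ i))))
    ≡⟨ go x w ⟩
  descFrom (suc (toℕ x)) (sentinel w)
    ≡⟨ ℤ.+-identityˡ _ ⟨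
  descFrom 0 (sentinel (x ∷ w))
    ∎
  where
  open ≡-Reasoning
  top : ∀ {k} (x : Fin k) → lt k (toℕ x) ≡ 0ℤ
  top zero    = refl
  top (suc x) = top x
  go : ∀ {ℓ} x (w : Vec (Fin k) ℓ) →
    sum (λ i → lt (toℕ (lookup w i)) (toℕ (lookup (x ∷ w) (inject₁ i)))) ≡ descFrom (suc (toℕ x)) (sentinel w)
  go x []      = sym (trans (ℤ.+-identityʳ _) (top x))
  go x (y ∷ w) = cong₂ _+_ (refl {x = lt (toℕ y) (toℕ x)}) (go y w)

-- Gaps after the insertion of one point

off : ∀ {n} → Fin n → Fin n → ℤ → ℤ
off zero    zero    x = 0ℤ
off zero    (suc _) x = x
off (suc _) zero    x = x
off (suc p) (suc q) x = off p q x

off-*ˡ : ∀ {n} (p q : Fin n) x y → y * off p q x ≡ off p q (y * x)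
off-*ˡ zero    zero    x y = ℤ.*-zeroʳ y
off-*ˡ zero    (suc q) x y = refl
off-*ˡ (suc p) zero    x y = refl
off-*ˡ (suc p) (suc q) x y = off-*ˡ p q x y

off-diag : ∀ {n} (p : Fin n) x → off p p x ≡ 0ℤ
off-diag zero    x = refl
off-diag (suc p) x = off-diag p x

sum-off : ∀ {n} (p : Fin n) (f : Fin n → ℤ) → sum (λ q → off p q (f q)) ≡ sum f - f p
sum-off zero    f = lemma (f zero) (sum (f ∘ suc))
  where
  lemma : ∀ a s → 0ℤ + s ≡ a + s - a
  lemma = solve-∀
sum-off (suc p) f = trans (cong₂ _+_ (refl {x = f zero}) (sum-off p (f ∘ suc))) (sym (ℤ.+-assoc (f zero) _ _))

-- `pinch p` takes the value p twice and every other value once.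
sum-pinch : ∀ {n} (p : Fin n) (f : Fin n → ℤ) → sum (f ∘ pinch p) ≡ sum f + f p
sum-pinch {suc n} zero f = ℤ.+-comm (f zero) (sum f)
sum-pinch {suc n} (suc p) f = trans (cong₂ _+_ (refl {x = f zero}) (sum-pinch p (f ∘ suc))) (sym (ℤ.+-assoc (f zero) _ _))

-- A gap a of the longer word lies between the same two letters as the gap `pinch p a` before,
-- except for the two gaps beside y. Both of these are sent to p, and there κ is assumed to vanish,
-- which is what `off` records.
neighbours-insertAt : ∀ {n} (κ : ℕ → ℕ → ℤ) h (v : Vec ℕ n) y (p : Fin n) (a : Fin (suc n)) →
  (a ≡ inject₁ p → ∀ l → κ l y ≡ 0ℤ) → (a ≡ suc p → ∀ r → κ y r ≡ 0ℤ) →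
  let v′ = insertAt v (inject₁ p) y; q = pinch p a in
  κ (lookup (h ∷ v′) (inject₁ a)) (lookup v′ a) ≡ off p q (κ (lookup (h ∷ v) (inject₁ q)) (lookup v q))
neighbours-insertAt κ h (x ∷ v) y zero    zero          κly κyr = κly refl h
neighbours-insertAt κ h (x ∷ v) y zero    (suc zero)    κly κyr = κyr refl x
neighbours-insertAt κ h (x ∷ v) y zero    (suc (suc a)) κly κyr = refl
neighbours-insertAt κ h (x ∷ v) y (suc p) zero          κly κyr = refl
neighbours-insertAt κ h (x ∷ v) y (suc p) (suc a)       κly κyr =
  neighbours-insertAt κ x v y p a (κly ∘ cong suc) (κyr ∘ cong suc)

-- With b = `punchIn a p` and q = `pinch p a`, the pairs (a, p) and (b, q) describe the same two
-- distinct elements in opposite orders. This equation and the next recover p and a from (b, q).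
pinch-punchIn : ∀ {n} (a : Fin (suc n)) (p : Fin n) → pinch (pinch p a) (punchIn a p) ≡ p
pinch-punchIn zero    zero    = refl
pinch-punchIn zero    (suc p) = refl
pinch-punchIn (suc zero)    zero = refl
pinch-punchIn (suc (suc a)) zero = refl
pinch-punchIn (suc a) (suc p) = cong suc (pinch-punchIn a p)

punchIn-pinch : ∀ {n} (a : Fin (suc n)) (p : Fin n) → punchIn (punchIn a p) (pinch p a) ≡ a
punchIn-pinch zero    zero    = refl
punchIn-pinch zero    (suc p) = refl
punchIn-pinch (suc a) zero    = refl
punchIn-pinch (suc a) (suc p) = cong suc (punchIn-pinch a p)

pinch-inject₁ : ∀ {n} (p : Fin n) → pinch p (inject₁ p) ≡ p
pinch-inject₁ zero    = refl
pinch-inject₁ (suc p) = cong suc (pinch-inject₁ p)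

pinch-suc : ∀ {n} (p : Fin n) → pinch p (suc p) ≡ p
pinch-suc zero    = refl
pinch-suc (suc p) = cong suc (pinch-suc p)

toℕ-punchIn-inject₁ : ∀ {n} (p : Fin n) → toℕ (punchIn (inject₁ p) p) ≡ suc (toℕ p)
toℕ-punchIn-inject₁ zero    = refl
toℕ-punchIn-inject₁ (suc p) = cong suc (toℕ-punchIn-inject₁ p)

toℕ-punchIn-suc : ∀ {n} (p : Fin n) → toℕ (punchIn (suc p) p) ≡ toℕ p
toℕ-punchIn-suc zero    = refl
toℕ-punchIn-suc (suc p) = cong suc (toℕ-punchIn-suc p)

-- Away from the first point, the second one meets the same neighbours and the same value gap as in
-- `w`, up to renumbering. If p = q it lands beside the first point and always adds a descent,
-- whence the factor `off`.
ε-insertPoint : ∀ {m} (w : Vec (Fin m) m) (a : Fin (suc (suc m))) (p : Fin (suc m)) →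
  let q = pinch p a in
  ε (insertPoint w p q) a (toℕ (punchIn a p)) ≡ off p q (ε w q (toℕ p))
ε-insertPoint w a p = begin
  ε (insertPoint w p q) a (toℕ b)
    ≡⟨ cong (λ s → gapBit (lookup (0 ∷ s) (inject₁ a)) (lookup s a) (toℕ b)) (sentinel-insertPoint w p q) ⟩
  gapBit (lookup (0 ∷ v″) (inject₁ a)) (lookup v″ a) (toℕ b)
    ≡⟨ neighbours-insertAt (λ l r → gapBit l r (toℕ b)) 0 v′ (suc c) p a left right ⟩
  off p q (gapBit (lookup (0 ∷ v′) (inject₁ q)) (lookup v′ q) (toℕ b))
    ≡⟨ cong (off p q) (cong₂ (λ l r → gapBit l r (toℕ b))
         (lookup-map (inject₁ q) (bump c) (0 ∷ v)) (lookup-map q (bump c) v)) ⟩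
  off p q (gapBit (bump c l) (bump c r) (toℕ b))
    ≡⟨ cong (off p q) (cong₂ _+_ (cong₂ _-_ (le-b l) (le-b r)) (lt-bump c r l)) ⟩
  off p q (ε w q (toℕ p))
    ∎
  where
  open ≡-Reasoning
  q  = pinch p a
  c  = toℕ q
  b  = punchIn a p
  v  = sentinel w
  v′ = map (bump c) v
  v″ = insertAt v′ (inject₁ p) (suc c)
  l  = lookup (0 ∷ v) (inject₁ q)
  r  = lookup v q
  le-b : ∀ i → le (bump c i) (toℕ b) ≡ le i (toℕ p)
  le-b i = trans (le-bump-pinch q i b) (cong (le i ∘ toℕ) (pinch-punchIn a p))
  -- Immediately to the left of the first point, the second goes just above it in value, so one
  -- descent is gained whatever l is.
  left : a ≡ inject₁ p → ∀ l → gapBit l (suc c) (toℕ b) ≡ 0ℤ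
  left refl l rewrite pinch-inject₁ p | toℕ-punchIn-inject₁ p | le-refl (toℕ p) | lt≡1-le (suc (toℕ p)) l =
    lemma (le l (suc (toℕ p)))
    where
    lemma : ∀ x → x - 1ℤ + (1ℤ - x) ≡ 0ℤ
    lemma = solve-∀
  -- Immediately to the right of the first point, the second goes just below it in value.
  right : a ≡ suc p → ∀ r → gapBit (suc c) r (toℕ b) ≡ 0ℤ
  right refl r rewrite pinch-suc p | toℕ-punchIn-suc p | lt-irrefl (toℕ p) = lemma (le r (toℕ p))
    where
    lemma : ∀ x → 0ℤ - x + x ≡ 0ℤ
    lemma = solve-∀

-- The sums of ε

sum-const : ∀ n x → sum {n} (λ _ → x) ≡ + n * x
sum-const zero    x = sym (ℤ.*-zeroˡ x)
sum-const (suc n) x = trans (cong₂ _+_ (refl {x = x}) (sum-const n x)) (sym (ℤ.suc-* (+ n) x))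

sum-telescope : ∀ {n} (g : Fin (suc n) → ℤ) →
  sum (λ p → g (inject₁ p) - g (suc p)) ≡ g zero - g (fromℕ n)
sum-telescope {zero}  g = sym (ℤ.+-inverseʳ (g zero))
sum-telescope {suc n} g = trans
  (cong₂ _+_ (refl {x = g zero - g (suc zero)}) (sum-telescope (g ∘ suc)))
  (lemma (g zero) (g (suc zero)) (g (fromℕ (suc n))))
  where
  lemma : ∀ a b c → a - b + (b - c) ≡ a - c
  lemma = solve-∀

-- The bracket [s ≤ q] starts the telescoping sum at s. The index s may be the last one, when no
-- term is left.
sum-telescope-from : ∀ {n} (s : Fin (suc n)) (g : Fin (suc n) → ℤ) →
  sum (λ q → le (toℕ s) (toℕ q) * (g (inject₁ q) - g (suc q))) ≡ g s - g (fromℕ n)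
sum-telescope-from zero g = trans (sum-cong-≗ (λ q → ℤ.*-identityˡ (g (inject₁ q) - g (suc q)))) (sum-telescope g)
sum-telescope-from {suc n} (suc s) g = trans
  (cong₂ _+_ (ℤ.*-zeroˡ (g zero - g (suc zero))) (sum-telescope-from s (g ∘ suc)))
  (ℤ.+-identityˡ _)

∑-distrib-minus : ∀ {n} (f g : Fin n → ℤ) → sum (λ i → f i - g i) ≡ sum f - sum g
∑-distrib-minus {zero}  f g = refl
∑-distrib-minus {suc n} f g = trans
  (cong₂ _+_ (refl {x = f zero - g zero}) (∑-distrib-minus (f ∘ suc) (g ∘ suc)))
  (regroup (f zero) (g zero) (sum (f ∘ suc)) (sum (g ∘ suc)))
  where
  regroup : ∀ a b c d → a - b + (c - d) ≡ a + c - (b + d)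
  regroup = solve-∀

∑∑-distrib-+ : ∀ {m n} (f g : Fin m → Fin n → ℤ) →
  sum (λ i → sum (λ j → f i j + g i j)) ≡ sum (λ i → sum (f i)) + sum (λ i → sum (g i))
∑∑-distrib-+ f g =
  trans (sum-cong-≗ (λ i → ∑-distrib-+ (f i) (g i))) (∑-distrib-+ (sum ∘ f) (sum ∘ g))

module GapMatrix {m} (e : Fin (suc (suc m)) → Fin (suc (suc m)))
  (e-involutive : Involutive _≡_ e)
  (e-zero : e zero ≡ zero)
  (e-top : e (fromℕ (suc m)) ≡ fromℕ (suc m))
  (e-fpf : ∀ (i : Fin m) → e (suc (inject₁ i)) ≢ suc (inject₁ i))
  where

  open ≡-Reasoning

  -- The part of ε(p,q) that depends on q. It is a difference of consecutive values of [e_t ≤ q] in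
  -- t, so it telescopes in p; `D p` is the remaining bracket for a descent at p.
  δ : Fin (suc m) → Fin (suc m) → ℤ
  δ p q = le (toℕ (e (inject₁ p))) (toℕ q) - le (toℕ (e (suc p))) (toℕ q)

  D : Fin (suc m) → ℤ
  D p = lt (toℕ (e (suc p))) (toℕ (e (inject₁ p)))

  E : Fin (suc m) → Fin (suc m) → ℤ
  E p q = δ p q + D p

  toℕ-e-top : toℕ (e (fromℕ (suc m))) ≡ suc m
  toℕ-e-top = trans (cong toℕ e-top) (toℕ-fromℕ (suc m))

  -- Summation by parts, with e ∘ e = id evaluating the boundary terms.
  sum-δδᵀ : ∀ p → sum (λ q → δ p q * δ q p) ≡ 1ℤ
  sum-δδᵀ p = begin
    sum (λ q → δ p q * δ q p)
      ≡⟨ sum-cong-≗ (λ q → distrib (le (toℕ s) (toℕ q)) (le (toℕ t) (toℕ q)) (δ q p)) ⟩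
    sum (λ q → le (toℕ s) (toℕ q) * δ q p - le (toℕ t) (toℕ q) * δ q p)
      ≡⟨ ∑-distrib-minus (λ q → le (toℕ s) (toℕ q) * δ q p) (λ q → le (toℕ t) (toℕ q) * δ q p) ⟩
    sum (λ q → le (toℕ s) (toℕ q) * δ q p) - sum (λ q → le (toℕ t) (toℕ q) * δ q p)
      ≡⟨ cong₂ _-_ (sum-telescope-from s g) (sum-telescope-from t g) ⟩
    g s - g (fromℕ (suc m)) - (g t - g (fromℕ (suc m)))
      ≡⟨ cancel (g s) (g t) (g (fromℕ (suc m))) ⟩
    g s - g t
      ≡⟨ cong₂ (λ a b → le a (toℕ p) - le b (toℕ p))
           (trans (cong toℕ (e-involutive (inject₁ p))) (toℕ-inject₁ p)) (cong toℕ (e-involutive (suc p))) ⟩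
    le (toℕ p) (toℕ p) - lt (toℕ p) (toℕ p)
      ≡⟨ cong₂ _-_ (le-refl (toℕ p)) (lt-irrefl (toℕ p)) ⟩
    1ℤ
      ∎
    where
    s = e (inject₁ p)
    t = e (suc p)
    g : Fin (suc (suc m)) → ℤ
    g q = le (toℕ (e q)) (toℕ p)
    distrib : ∀ a b c → (a - b) * c ≡ a * c - b * c
    distrib = solve-∀
    cancel : ∀ a b c → a - c - (b - c) ≡ a - b
    cancel = solve-∀

  -- The sum telescopes to its ends, where e_0 = 0 is at most q and e_{m+1} = m + 1 exceeds q.
  sum-δ : ∀ q → sum (λ p → δ p q) ≡ 1ℤ
  sum-δ q = begin
    sum (λ p → δ p q)
      ≡⟨ sum-telescope (λ t → le (toℕ (e t)) (toℕ q)) ⟩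
    le (toℕ (e zero)) (toℕ q) - le (toℕ (e (fromℕ (suc m)))) (toℕ q)
      ≡⟨ cong₂ (λ a b → le a (toℕ q) - le b (toℕ q)) (cong toℕ e-zero) toℕ-e-top ⟩
    1ℤ - lt m (toℕ q)
      ≡⟨ lt≡1-le (toℕ q) (suc m) ⟨
    lt (toℕ q) (suc m)
      ≡⟨ <⇒lt (toℕ<n q) ⟩
    1ℤ
      ∎

  -- Since e_{p+1} ≠ p + 1 for p < m, the bracket [e_{p+1} ≤ p] equals [e_{p+1} ≤ p + 1], and the
  -- diagonal telescopes too. The term p = m is split off because m + 1 is fixed by e.
  sum-δ-diag : sum (λ p → δ p p) ≡ 1ℤ
  sum-δ-diag = begin
    sum (λ p → δ p p)
      ≡⟨ sum-init-last (λ p → δ p p) ⟩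
    sum (λ p → δ (inject₁ p) (inject₁ p)) + δ (fromℕ m) (fromℕ m)
      ≡⟨ cong₂ _+_ (trans (sum-cong-≗ inner) (sum-telescope g)) last ⟩
    g zero - g (fromℕ m) + g (fromℕ m)
      ≡⟨ cancel (g zero) (g (fromℕ m)) ⟩
    g zero
      ≡⟨ cong (λ t → le (toℕ t) 0) e-zero ⟩
    1ℤ
      ∎
    where
    g : Fin (suc m) → ℤ
    g p = le (toℕ (e (inject₁ p))) (toℕ p)
    inner : ∀ p → δ (inject₁ p) (inject₁ p) ≡ g (inject₁ p) - g (suc p)
    inner p = cong₂ _-_ (refl {x = g (inject₁ p)})
      (trans (le-suc-≢ (toℕ (e (suc (inject₁ p)))) (toℕ (inject₁ p)) (e-fpf p ∘ toℕ-injective))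
        (cong (le (toℕ (e (suc (inject₁ p)))) ∘ suc) (toℕ-inject₁ p)))
    last : δ (fromℕ m) (fromℕ m) ≡ g (fromℕ m)
    last = trans (cong₂ _-_ (refl {x = g (fromℕ m)}) (begin
        le (toℕ (e (fromℕ (suc m)))) (toℕ (fromℕ m)) ≡⟨ cong₂ le toℕ-e-top (toℕ-fromℕ m) ⟩
        lt m m                                       ≡⟨ lt-irrefl m ⟩
        0ℤ                                           ∎))
      (ℤ.+-identityʳ (g (fromℕ m)))
    cancel : ∀ a b → a - b + b ≡ a
    cancel = solve-∀

  d : ℤ
  d = sum D

  sum-E-column : ∀ q → sum (λ p → E p q) ≡ 1ℤ + d
  sum-E-column q = trans (∑-distrib-+ (λ p → δ p q) D) (cong₂ _+_ (sum-δ q) refl)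

  sum-E-diag : sum (λ p → E p p) ≡ 1ℤ + d
  sum-E-diag = trans (∑-distrib-+ (λ p → δ p p) D) (cong₂ _+_ sum-δ-diag refl)

  ∑∑Eᵀ : sum (λ p → sum (λ q → E q p)) ≡ + suc m * (1ℤ + d)
  ∑∑Eᵀ = trans (sum-cong-≗ sum-E-column) (sum-const (suc m) (1ℤ + d))

  ∑∑E : sum (λ p → sum (λ q → E p q)) ≡ + suc m * (1ℤ + d)
  ∑∑E = trans (∑-comm E) ∑∑Eᵀ

  -- Of the four products of `δ` and `D`, the one of `δ` with its transpose gives 1 for each p, each
  -- mixed product gives `d` because the columns of `δ` sum to 1, and the last gives `d * d`.
  ∑∑EEᵀ : sum (λ p → sum (λ q → E p q * E q p)) ≡ + suc m + (d + d) + d * d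
  ∑∑EEᵀ = begin
    sum (λ p → sum (λ q → E p q * E q p))
      ≡⟨ sum-cong-≗ (λ p → sum-cong-≗ (λ q → expand (δ p q) (D p) (δ q p) (D q))) ⟩
    sum (λ p → sum (λ q → δ p q * δ q p + (δ p q * D q + D p * δ q p) + D p * D q))
      ≡⟨ ∑∑-distrib-+ (λ p q → δ p q * δ q p + (δ p q * D q + D p * δ q p)) (λ p q → D p * D q) ⟩
    sum (λ p → sum (λ q → δ p q * δ q p + (δ p q * D q + D p * δ q p))) + sum (λ p → sum (λ q → D p * D q))
      ≡⟨ cong₂ _+_
           (trans (∑∑-distrib-+ (λ p q → δ p q * δ q p) (λ p q → δ p q * D q + D p * δ q p))
             (cong₂ _+_ quadratic
               (trans (∑∑-distrib-+ (λ p q → δ p q * D q) (λ p q → D p * δ q p))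
                 (cong₂ _+_ (trans (∑-comm (λ p q → δ p q * D q)) mixedˡ) mixedʳ))))
           constant ⟩
    + suc m + (d + d) + d * d
      ∎
    where
    expand : ∀ a b c d → (a + b) * (c + d) ≡ a * c + (a * d + b * c) + b * d
    expand = solve-∀
    quadratic : sum (λ p → sum (λ q → δ p q * δ q p)) ≡ + suc m
    quadratic = trans (sum-cong-≗ sum-δδᵀ) (trans (sum-const (suc m) 1ℤ) (ℤ.*-identityʳ _))
    mixedˡ : sum (λ q → sum (λ p → δ p q * D q)) ≡ d
    mixedˡ = sum-cong-≗ (λ q → trans (sym (*-distribʳ-sum (D q) (λ p → δ p q)))
      (trans (cong (_* D q) (sum-δ q)) (ℤ.*-identityˡ (D q))))
    mixedʳ : sum (λ p → sum (λ q → D p * δ q p)) ≡ d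
    mixedʳ = sum-cong-≗ (λ p → trans (sym (*-distribˡ-sum (D p) (λ q → δ q p)))
      (trans (cong₂ _*_ (refl {x = D p}) (sum-δ p)) (ℤ.*-identityʳ (D p))))
    constant : sum (λ p → sum (λ q → D p * D q)) ≡ d * d
    constant = trans (sum-cong-≗ (λ p → sym (*-distribˡ-sum (D p) D))) (sym (*-distribʳ-sum d D))

-- Extension of an involution by fixed points at both ends

sum-descFrom : ∀ {n} h (v : Vec ℕ n) →
  sum (λ p → lt (lookup v p) (lookup (h ∷ v) (inject₁ p))) ≡ descFrom h v
sum-descFrom h []      = refl
sum-descFrom h (x ∷ v) = cong₂ _+_ (refl {x = lt x h}) (sum-descFrom x v)

-- The word e of the overview as a self-map of `Fin (suc (suc m))`. The natural numbers of
-- `sentinel` do not suffice here, since e has to be composed with itself.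
extend : ∀ {m} → Word m → Fin (suc (suc m)) → Fin (suc (suc m))
extend {m} σ = lookup (zero ∷ (map (suc ∘ inject₁) σ ∷ʳ fromℕ (suc m)))

module _ {a} {A : Set a} where

  lookup-∷ʳ-inject₁ : ∀ {n} (v : Vec A n) x i → lookup (v ∷ʳ x) (inject₁ i) ≡ lookup v i
  lookup-∷ʳ-inject₁ (y ∷ v) x zero    = refl
  lookup-∷ʳ-inject₁ (y ∷ v) x (suc i) = lookup-∷ʳ-inject₁ v x i

  lookup-∷ʳ-fromℕ : ∀ {n} (v : Vec A n) x → lookup (v ∷ʳ x) (fromℕ n) ≡ x
  lookup-∷ʳ-fromℕ []      x = refl
  lookup-∷ʳ-fromℕ (y ∷ v) x = lookup-∷ʳ-fromℕ v x

extend-inject₁ : ∀ {m} (σ : Word m) i → extend σ (suc (inject₁ i)) ≡ suc (inject₁ (lookup σ i))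
extend-inject₁ {m} σ i = trans (lookup-∷ʳ-inject₁ (map (suc ∘ inject₁) σ) (fromℕ (suc m)) i)
  (lookup-map i (suc ∘ inject₁) σ)

extend-top : ∀ {m} (σ : Word m) → extend σ (fromℕ (suc m)) ≡ fromℕ (suc m)
extend-top {m} σ = lookup-∷ʳ-fromℕ (map (suc ∘ inject₁) σ) (fromℕ (suc m))

toℕ-extend : ∀ {m} (σ : Word m) t → toℕ (extend σ t) ≡ lookup (0 ∷ sentinel σ) t
toℕ-extend σ zero    = refl
toℕ-extend σ (suc t) with view t
... | ‵fromℕ = begin
  toℕ (extend σ (fromℕ _))              ≡⟨ cong toℕ (extend-top σ) ⟩
  toℕ (fromℕ _)                         ≡⟨ toℕ-fromℕ _ ⟩
  _                                     ≡⟨ lookup-∷ʳ-fromℕ (map (suc ∘ toℕ) σ) _ ⟨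
  lookup (sentinel σ) (fromℕ _)         ∎
  where open ≡-Reasoning
... | ‵inject₁ i = begin
  toℕ (extend σ (suc (inject₁ i)))      ≡⟨ cong toℕ (extend-inject₁ σ i) ⟩
  suc (toℕ (inject₁ (lookup σ i)))      ≡⟨ cong suc (toℕ-inject₁ (lookup σ i)) ⟩
  suc (toℕ (lookup σ i))                ≡⟨ lookup-map i (suc ∘ toℕ) σ ⟨
  lookup (map (suc ∘ toℕ) σ) i          ≡⟨ lookup-∷ʳ-inject₁ (map (suc ∘ toℕ) σ) _ i ⟨
  lookup (sentinel σ) (inject₁ i)       ∎
  where open ≡-Reasoning

extend-involutive : ∀ {m} {σ : Word m} → Involutive _≡_ (lookup σ) → Involutive _≡_ (extend σ)
extend-involutive         inv zero    = refl
extend-involutive {σ = σ} inv (suc t) with view t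
... | ‵fromℕ = trans (cong (extend σ) (extend-top σ)) (extend-top σ)
... | ‵inject₁ i = begin
  extend σ (extend σ (suc (inject₁ i)))     ≡⟨ cong (extend σ) (extend-inject₁ σ i) ⟩
  extend σ (suc (inject₁ (lookup σ i)))     ≡⟨ extend-inject₁ σ (lookup σ i) ⟩
  suc (inject₁ (lookup σ (lookup σ i)))     ≡⟨ cong (suc ∘ inject₁) (inv i) ⟩
  suc (inject₁ i)                           ∎
  where open ≡-Reasoning

extend-fpf : ∀ {m} {σ : Word m} → FixedPointFree σ →
  ∀ i → extend σ (suc (inject₁ i)) ≢ suc (inject₁ i)
extend-fpf {σ = σ} fpf i eq =
  fpf i (inject₁-injective (suc-injective (trans (sym (extend-inject₁ σ i)) eq)))

-- Insertion of a 2-cycle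

-- Inserts the 2-cycle (a b) with b = punchIn a p: first the point (b, a), numbered among
-- the letters other than b, then the point (a, b).

insertCycle : ∀ {m} → Word m → Fin (suc (suc m)) → Fin (suc m) → Word (suc (suc m))
insertCycle σ a p = insertPoint (insertPoint σ p (pinch p a)) a (punchIn a p)

descents-insertPoint : ∀ {k ℓ} (w : Vec (Fin k) ℓ) p q →
  + descents (insertPoint w p q) ≡ + descents w + (1ℤ - ε w p (toℕ q))
descents-insertPoint w p q = begin
  + descents (insertPoint w p q)
    ≡⟨ descents≡descFrom (insertPoint w p q) ⟩
  descFrom 0 (sentinel (insertPoint w p q))
    ≡⟨ descFrom-insertPoint w p q ⟩
  descFrom 0 (sentinel w) + (1ℤ - ε w p (toℕ q))
    ≡⟨ cong (_+ (1ℤ - ε w p (toℕ q))) (descents≡descFrom w) ⟨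
  + descents w + (1ℤ - ε w p (toℕ q))
    ∎
  where open ≡-Reasoning

descents-insertCycle : ∀ {m} (σ : Word m) a p → let q = pinch p a in
  + descents (insertCycle σ a p) ≡ + descents σ + (1ℤ - ε σ p (toℕ q)) + (1ℤ - off p q (ε σ q (toℕ p)))
descents-insertCycle σ a p = trans (descents-insertPoint (insertPoint σ p (pinch p a)) a (punchIn a p))
  (cong₂ (λ x y → x + (1ℤ - y)) (descents-insertPoint σ p (pinch p a)) (ε-insertPoint σ a p))

off-isBit : ∀ {n} (p q : Fin n) {x} → IsBit x → IsBit (off p q x)
off-isBit zero    zero    bx = inj₁ refl
off-isBit zero    (suc q) bx = bx
off-isBit (suc p) zero    bx = bx
off-isBit (suc p) (suc q) bx = off-isBit p q bx

bit-idem : ∀ {x} → IsBit x → x * x ≡ x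
bit-idem (inj₁ refl) = refl
bit-idem (inj₂ refl) = refl

-- For bits, (x + y, x * y) is (0, 0), (1, 0) or (2, 1), so any function of x + y is affine in these
-- two quantities. The coefficients are the first and second differences of χ; hence only sums of ε
-- and of ε(p,q)ε(q,p) are needed later.
bit-interpolation : ∀ (χ : ℤ → ℤ) d {x y} → IsBit x → IsBit y →
  χ (d + (1ℤ - x) + (1ℤ - y)) ≡
    χ (d + + 2) + (x + y) * (χ (d + 1ℤ) - χ (d + + 2)) + x * y * (χ d - + 2 * χ (d + 1ℤ) + χ (d + + 2))
bit-interpolation χ d bx by = go bx by
  where
  l₀ : ∀ a b c → a ≡ a + 0ℤ * (b - a) + 0ℤ * (c - + 2 * b + a)
  l₀ = solve-∀
  l₁ : ∀ a b c → b ≡ a + 1ℤ * (b - a) + 0ℤ * (c - + 2 * b + a)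
  l₁ = solve-∀
  l₂ : ∀ a b c → c ≡ a + + 2 * (b - a) + 1ℤ * (c - + 2 * b + a)
  l₂ = solve-∀
  go : ∀ {x y} → IsBit x → IsBit y → χ (d + (1ℤ - x) + (1ℤ - y)) ≡
    χ (d + + 2) + (x + y) * (χ (d + 1ℤ) - χ (d + + 2)) + x * y * (χ d - + 2 * χ (d + 1ℤ) + χ (d + + 2))
  go (inj₁ refl) (inj₁ refl) = trans (cong χ (ℤ.+-assoc d 1ℤ 1ℤ)) (l₀ (χ (d + + 2)) (χ (d + 1ℤ)) (χ d))
  go (inj₁ refl) (inj₂ refl) = trans (cong χ (ℤ.+-assoc d 1ℤ 0ℤ)) (l₁ (χ (d + + 2)) (χ (d + 1ℤ)) (χ d))
  go (inj₂ refl) (inj₁ refl) = trans (cong χ (ℤ.+-assoc d 0ℤ 1ℤ)) (l₁ (χ (d + + 2)) (χ (d + 1ℤ)) (χ d))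
  go (inj₂ refl) (inj₂ refl) = trans (cong χ (trans (ℤ.+-assoc d 0ℤ 0ℤ) (ℤ.+-identityʳ d))) (l₂ (χ (d + + 2)) (χ (d + 1ℤ)) (χ d))

sum-affine : ∀ {n} (f g : Fin n → ℤ) a b c →
  sum (λ i → a + f i * b + g i * c) ≡ + n * a + sum f * b + sum g * c
sum-affine {n} f g a b c = begin
  sum (λ i → a + f i * b + g i * c)
    ≡⟨ ∑-distrib-+ (λ i → a + f i * b) (λ i → g i * c) ⟩
  sum (λ i → a + f i * b) + sum (λ i → g i * c)
    ≡⟨ cong₂ _+_ (trans (∑-distrib-+ (λ _ → a) (λ i → f i * b))
         (cong₂ _+_ (sum-const n a) (sym (*-distribʳ-sum b f)))) (sym (*-distribʳ-sum c g)) ⟩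
  + n * a + sum f * b + sum g * c
    ∎
  where open ≡-Reasoning

-- The three coefficients are the numbers of pairs (a, p) whose insertion creates 0, 1 and 2
-- descents. An arbitrary χ treats the three counts at once.
∑∑-insertCycle : ∀ {m} (σ : Word m) → IsFPFInvolution σ → (χ : ℤ → ℤ) →
  let d = + descents σ in
  sum (λ a → sum (λ p → χ (+ descents (insertCycle σ a p)))) ≡
    (d * (d + 1ℤ) + + m) * χ d
    + + 2 * (d * (+ m - d) + 1ℤ) * χ (d + 1ℤ)
    + ((+ m - d) * (+ m - d + 1ℤ) + + m) * χ (d + + 2)
∑∑-insertCycle {m} σ (_ , inv , fpf) χ = begin
  sum (λ a → sum (λ p → χ (+ descents (insertCycle σ a p))))
    ≡⟨ sum-cong-≗ (λ a → sum-cong-≗ (λ p → trans (cong χ (descents-insertCycle σ a p))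
         (bit-interpolation χ dσ (ε-bit p (pinch p a)) (off-isBit p (pinch p a) (ε-bit (pinch p a) p))))) ⟩
  sum (λ a → sum (λ p → F p (pinch p a)))
    ≡⟨ ∑-comm (λ a p → F p (pinch p a)) ⟩
  sum (λ p → sum (λ a → F p (pinch p a)))
    -- For fixed p the gap q = p arises from two values of a, namely p and p + 1, and every other
    -- gap from one.
    ≡⟨ sum-cong-≗ (λ p → trans (sum-pinch p (F p)) (inner p)) ⟩
  sum (λ p → + suc (suc m) * f₂ + (row p + col p) * A + (quad p - ε′ p p) * B)
    ≡⟨ sum-affine (λ p → row p + col p) (λ p → quad p - ε′ p p) (+ suc (suc m) * f₂) A B ⟩
  + suc m * (+ suc (suc m) * f₂) + sum (λ p → row p + col p) * A + sum (λ p → quad p - ε′ p p) * B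
    ≡⟨ cong₂ (λ x y → + suc m * (+ suc (suc m) * f₂) + x * A + y * B)
         (trans (∑-distrib-+ row col) (cong₂ _+_ ∑row ∑col))
         (trans (∑-distrib-minus quad (λ p → ε′ p p)) (cong₂ _-_ ∑quad ∑diag)) ⟩
  + suc m * (+ suc (suc m) * f₂)
    + (+ suc m * (1ℤ + dσ) + + suc m * (1ℤ + dσ)) * A
    + (+ suc m + (dσ + dσ) + dσ * dσ - (1ℤ + dσ)) * B
    ≡⟨ final (+ m) dσ f₀ f₁ f₂ ⟩
  (dσ * (dσ + 1ℤ) + + m) * f₀ + + 2 * (dσ * (+ m - dσ) + 1ℤ) * f₁ + ((+ m - dσ) * (+ m - dσ + 1ℤ) + + m) * f₂
    ∎
  where
  open ≡-Reasoning
  module G = GapMatrix (extend σ) (extend-involutive {σ = σ} inv) refl (extend-top σ) (extend-fpf {σ = σ} fpf)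
  dσ = + descents σ
  f₀ = χ dσ
  f₁ = χ (dσ + 1ℤ)
  f₂ = χ (dσ + + 2)
  A  = f₁ - f₂
  B  = f₀ - + 2 * f₁ + f₂
  ε′ : Fin (suc m) → Fin (suc m) → ℤ
  ε′ p q = ε σ p (toℕ q)
  ε-bit : ∀ p q → IsBit (ε′ p q)
  ε-bit p q = gapBit-isBit (lookup (0 ∷ sentinel σ) (inject₁ p)) (lookup (sentinel σ) p) (toℕ q)
  E≡ε : ∀ p q → G.E p q ≡ ε′ p q
  E≡ε p q = cong₂ (λ l r → gapBit l r (toℕ q)) (toℕ-extend σ (inject₁ p)) (toℕ-extend σ (suc p))
  d≡dσ : G.d ≡ dσ
  d≡dσ = trans (sum-cong-≗ (λ p → cong₂ lt (toℕ-extend σ (suc p)) (toℕ-extend σ (inject₁ p))))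
    (trans (sum-descFrom 0 (sentinel σ)) (sym (descents≡descFrom σ)))
  F : Fin (suc m) → Fin (suc m) → ℤ
  F p q = f₂ + (ε′ p q + off p q (ε′ q p)) * A + ε′ p q * off p q (ε′ q p) * B
  row col quad : Fin (suc m) → ℤ
  row p  = sum (λ q → ε′ p q)
  col p  = sum (λ q → ε′ q p)
  quad p = sum (λ q → ε′ p q * ε′ q p)
  ∑row : sum row ≡ + suc m * (1ℤ + dσ)
  ∑row = trans (sum-cong-≗ (λ p → sum-cong-≗ (λ q → sym (E≡ε p q)))) (trans G.∑∑E (cong (λ d → + suc m * (1ℤ + d)) d≡dσ))
  ∑col : sum col ≡ + suc m * (1ℤ + dσ)
  ∑col = trans (sum-cong-≗ (λ p → sum-cong-≗ (λ q → sym (E≡ε q p)))) (trans G.∑∑Eᵀ (cong (λ d → + suc m * (1ℤ + d)) d≡dσ))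
  ∑quad : sum quad ≡ + suc m + (dσ + dσ) + dσ * dσ
  ∑quad = trans (sum-cong-≗ (λ p → sum-cong-≗ (λ q → sym (cong₂ _*_ (E≡ε p q) (E≡ε q p)))))
    (trans G.∑∑EEᵀ (cong (λ d → + suc m + (d + d) + d * d) d≡dσ))
  ∑diag : sum (λ p → ε′ p p) ≡ 1ℤ + dσ
  ∑diag = trans (sum-cong-≗ (λ p → sym (E≡ε p p))) (trans G.sum-E-diag (cong₂ _+_ (refl {x = 1ℤ}) d≡dσ))
  inner : ∀ p → sum (F p) + F p p ≡ + suc (suc m) * f₂ + (row p + col p) * A + (quad p - ε′ p p) * B
  inner p = begin
    sum (F p) + F p p
      ≡⟨ cong₂ _+_ (sum-affine (λ q → ε′ p q + off p q (ε′ q p)) (λ q → ε′ p q * off p q (ε′ q p)) f₂ A B)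
           (cong (λ z → f₂ + (x + z) * A + x * z * B) (off-diag p x)) ⟩
    + suc m * f₂ + sum (λ q → ε′ p q + off p q (ε′ q p)) * A + sum (λ q → ε′ p q * off p q (ε′ q p)) * B
      + (f₂ + (x + 0ℤ) * A + x * 0ℤ * B)
      ≡⟨ cong₂ (λ s t → + suc m * f₂ + s * A + t * B + (f₂ + (x + 0ℤ) * A + x * 0ℤ * B))
           (trans (∑-distrib-+ (λ q → ε′ p q) (λ q → off p q (ε′ q p)))
             (cong₂ _+_ (refl {x = row p}) (sum-off p (λ q → ε′ q p))))
           -- The diagonal term removed here is the square of a bit, hence the bit itself.
           (trans (sum-cong-≗ (λ q → off-*ˡ p q (ε′ q p) (ε′ p q)))
             (trans (sum-off p (λ q → ε′ p q * ε′ q p)) (cong₂ _-_ (refl {x = quad p}) (bit-idem (ε-bit p p))))) ⟩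
    + suc m * f₂ + (row p + (col p - x)) * A + (quad p - x) * B + (f₂ + (x + 0ℤ) * A + x * 0ℤ * B)
      ≡⟨ regroup (+ suc m) f₂ A B (row p) (col p) (quad p) x ⟩
    + suc (suc m) * f₂ + (row p + col p) * A + (quad p - x) * B
      ∎
    where
    x = ε′ p p
    regroup : ∀ n f a b r c q x → n * f + (r + (c - x)) * a + (q - x) * b + (f + (x + 0ℤ) * a + x * 0ℤ * b)
      ≡ (1ℤ + n) * f + (r + c) * a + (q - x) * b
    regroup = solve-∀
  final : ∀ m d f₀ f₁ f₂ →
    (1ℤ + m) * ((+ 2 + m) * f₂) + ((1ℤ + m) * (1ℤ + d) + (1ℤ + m) * (1ℤ + d)) * (f₁ - f₂)
      + (1ℤ + m + (d + d) + d * d - (1ℤ + d)) * (f₀ - + 2 * f₁ + f₂)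
    ≡ (d * (d + 1ℤ) + m) * f₀ + + 2 * (d * (m - d) + 1ℤ) * f₁ + ((m - d) * (m - d + 1ℤ) + m) * f₂
  final = solve-∀

-- Removal of a 2-cycle

lookup-extensional : ∀ {a} {A : Set a} {n} {v w : Vec A n} → lookup v ≗ lookup w → v ≡ w
lookup-extensional {v = v} {w} eq =
  trans (sym (tabulate∘lookup v)) (trans (tabulate-cong eq) (tabulate∘lookup w))

punchIn-view : ∀ {n} (a j : Fin (suc n)) → j ≡ a ⊎ ∃ λ i → j ≡ punchIn a i
punchIn-view a j with a ≟ j
... | yes a≡j = inj₁ (sym a≡j)
... | no  a≢j = inj₂ (punchOut a≢j , sym (punchIn-punchOut a≢j))

-- Both sides list in increasing order what remains when the same two elements are skipped, in
-- either order.
punchIn-swap : ∀ {n} (a : Fin (suc (suc n))) (p : Fin (suc n)) i →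
  punchIn (punchIn a p) (punchIn (pinch p a) i) ≡ punchIn a (punchIn p i)
punchIn-swap zero    zero    i       = refl
punchIn-swap zero    (suc p) i       = refl
punchIn-swap (suc a) zero    i       = refl
punchIn-swap (suc a) (suc p) zero    = refl
punchIn-swap (suc a) (suc p) (suc i) = cong suc (punchIn-swap a p i)

involutive⇒injective : ∀ {a} {A : Set a} {f : A → A} → Involutive _≡_ f → ∀ {x y} → f x ≡ f y → x ≡ y
involutive⇒injective {f = f} inv {x} {y} eq = trans (sym (inv x)) (trans (cong f eq) (inv y))

isFPFInvolution : ∀ {m} {π : Word m} → Involutive _≡_ (lookup π) → FixedPointFree π → IsFPFInvolution π
isFPFInvolution {π = π} inv fpf =
  subst IsPermutation (tabulate∘lookup π) (VecUnique.tabulate⁺ (involutive⇒injective {f = lookup π} inv)) , inv , fpf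

lookup-insertPoint : ∀ {k ℓ} (w : Vec (Fin k) ℓ) p q → lookup (insertPoint w p q) p ≡ q
lookup-insertPoint w p q = insertAt-lookup (map (punchIn q) w) p q

lookup-insertPoint-punchIn : ∀ {k ℓ} (w : Vec (Fin k) ℓ) p q i →
  lookup (insertPoint w p q) (punchIn p i) ≡ punchIn q (lookup w i)
lookup-insertPoint-punchIn w p q i =
  trans (insertAt-punchIn (map (punchIn q) w) p q i) (lookup-map i (punchIn q) w)

relabel : ∀ {m} → Fin (suc (suc m)) → Fin (suc m) → Fin m → Fin (suc (suc m))
relabel a p i = punchIn a (punchIn p i)

relabel-injective : ∀ {m} (a : Fin (suc (suc m))) p {i j} → relabel a p i ≡ relabel a p j → i ≡ j
relabel-injective a p eq = punchIn-injective p _ _ (punchIn-injective a _ _ eq)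

data Position {m} (a : Fin (suc (suc m))) (p : Fin (suc m)) : Fin (suc (suc m)) → Set where
  first  : Position a p a
  second : Position a p (punchIn a p)
  old    : ∀ i → Position a p (relabel a p i)

position : ∀ {m} (a : Fin (suc (suc m))) p j → Position a p j
position a p j with punchIn-view a j
... | inj₁ refl = first
... | inj₂ (i , refl) with punchIn-view p i
...   | inj₁ refl = second
...   | inj₂ (i , refl) = old i

module _ {m} (σ : Word m) (a : Fin (suc (suc m))) (p : Fin (suc m)) where

  private
    τ = insertPoint σ p (pinch p a)
    π = insertCycle σ a p

  insertCycle-first : lookup π a ≡ punchIn a p
  insertCycle-first = lookup-insertPoint τ a (punchIn a p)

  insertCycle-second : lookup π (punchIn a p) ≡ a
  insertCycle-second = begin
    lookup π (punchIn a p)             ≡⟨ lookup-insertPoint-punchIn τ a (punchIn a p) p ⟩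
    punchIn (punchIn a p) (lookup τ p) ≡⟨ cong (punchIn (punchIn a p)) (lookup-insertPoint σ p (pinch p a)) ⟩
    punchIn (punchIn a p) (pinch p a)  ≡⟨ punchIn-pinch a p ⟩
    a                                  ∎
    where open ≡-Reasoning

  insertCycle-old : ∀ i → lookup π (relabel a p i) ≡ relabel a p (lookup σ i)
  insertCycle-old i = begin
    lookup π (relabel a p i)                              ≡⟨ lookup-insertPoint-punchIn τ a (punchIn a p) (punchIn p i) ⟩
    punchIn (punchIn a p) (lookup τ (punchIn p i))        ≡⟨ cong (punchIn (punchIn a p)) (lookup-insertPoint-punchIn σ p (pinch p a) i) ⟩
    punchIn (punchIn a p) (punchIn (pinch p a) (lookup σ i)) ≡⟨ punchIn-swap a p (lookup σ i) ⟩
    relabel a p (lookup σ i)                              ∎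
    where open ≡-Reasoning

  insertCycle-isFPFInvolution : IsFPFInvolution σ → IsFPFInvolution π
  insertCycle-isFPFInvolution (_ , inv , fpf) = isFPFInvolution inv′ fpf′
    where
    inv′ : Involutive _≡_ (lookup π)
    inv′ j with position a p j
    ... | first  = trans (cong (lookup π) insertCycle-first) insertCycle-second
    ... | second = trans (cong (lookup π) insertCycle-second) insertCycle-first
    ... | old i  = trans (cong (lookup π) (insertCycle-old i))
      (trans (insertCycle-old (lookup σ i)) (cong (relabel a p) (inv i)))
    fpf′ : FixedPointFree π
    fpf′ j eq with position a p j
    ... | first  = punchInᵢ≢i a p (trans (sym insertCycle-first) eq)
    ... | second = punchInᵢ≢i a p (trans (sym eq) insertCycle-second)
    ... | old i  = fpf i (relabel-injective a p (trans (sym (insertCycle-old i)) eq))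

MarkedWord : ℕ → Set
MarkedWord m = Word m × Fin m

insertMarked : ∀ {m} → Word m × Fin (suc (suc m)) × Fin (suc m) → MarkedWord (suc (suc m))
insertMarked (σ , a , p) = insertCycle σ a p , a

-- The mark gives a, its image under the word gives b and hence p, and the remaining letters give σ.
insertMarked-injective : ∀ {m} {x y : Word m × Fin (suc (suc m)) × Fin (suc m)} →
  insertMarked x ≡ insertMarked y → x ≡ y
insertMarked-injective {x = σ , a , p} {σ′ , a′ , p′} eq with refl ← cong proj₂ eq
  with refl ← punchIn-injective a p p′ (trans (sym (insertCycle-first σ a p))
                (trans (cong (λ z → lookup (proj₁ z) a) eq) (insertCycle-first σ′ a p′)))
  = cong (_, a , p) (lookup-extensional λ i → relabel-injective a p (begin
      relabel a p (lookup σ i)                        ≡⟨ insertCycle-old σ a p i ⟨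
      lookup (insertCycle σ a p) (relabel a p i)      ≡⟨ cong (λ z → lookup (proj₁ z) (relabel a p i)) eq ⟩
      lookup (insertCycle σ′ a p) (relabel a p i)     ≡⟨ insertCycle-old σ′ a p i ⟩
      relabel a p (lookup σ′ i)                       ∎))
  where open ≡-Reasoning

-- The image of a must be b, which determines p. The complement of the cycle {a, b} is stable under
-- π, and σ is the renumbered restriction of π to it.
insertMarked-surjective : ∀ {m} (π : Word (suc (suc m))) a → IsFPFInvolution π →
  ∃ λ σ → ∃ λ p → IsFPFInvolution σ × π ≡ insertCycle σ a p
insertMarked-surjective {m} π a (_ , inv , fpf) =
  σ , p , isFPFInvolution σ-inv σ-fpf , lookup-extensional π≗
  where
  open ≡-Reasoning
  a≢πa : a ≢ lookup π a
  a≢πa = fpf a ∘ sym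
  p = punchOut a≢πa
  π-first : lookup π a ≡ punchIn a p
  π-first = sym (punchIn-punchOut a≢πa)
  π-second : lookup π (punchIn a p) ≡ a
  π-second = trans (cong (lookup π) (sym π-first)) (inv a)
  restrict : ∀ i → ∃ λ s → lookup π (relabel a p i) ≡ relabel a p s
  restrict i = go (position a p (lookup π (relabel a p i))) refl
    where
    go : ∀ {j} → Position a p j → lookup π (relabel a p i) ≡ j →
      ∃ λ s → lookup π (relabel a p i) ≡ relabel a p s
    -- By injectivity of π, only b is sent to a and only a is sent to b.
    go first   eq = contradiction
      (punchIn-injective a _ _ (involutive⇒injective {f = lookup π} inv (trans eq (sym π-second))))
      (punchInᵢ≢i p i)
    go second  eq = contradiction (involutive⇒injective {f = lookup π} inv (trans eq (sym π-first)))
      (punchInᵢ≢i a (punchIn p i))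
    go (old s) eq = s , eq
  σ : Word m
  σ = tabulate (proj₁ ∘ restrict)
  π-old : ∀ i → lookup π (relabel a p i) ≡ relabel a p (lookup σ i)
  π-old i = trans (proj₂ (restrict i)) (cong (relabel a p) (sym (lookup∘tabulate (proj₁ ∘ restrict) i)))
  σ-inv : Involutive _≡_ (lookup σ)
  σ-inv i = relabel-injective a p (begin
    relabel a p (lookup σ (lookup σ i))      ≡⟨ π-old (lookup σ i) ⟨
    lookup π (relabel a p (lookup σ i))      ≡⟨ cong (lookup π) (π-old i) ⟨
    lookup π (lookup π (relabel a p i))      ≡⟨ inv (relabel a p i) ⟩
    relabel a p i                            ∎)
  σ-fpf : FixedPointFree σ
  σ-fpf i eq = fpf (relabel a p i) (trans (π-old i) (cong (relabel a p) eq))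
  π≗ : lookup π ≗ lookup (insertCycle σ a p)
  π≗ j with position a p j
  ... | first  = trans π-first (sym (insertCycle-first σ a p))
  ... | second = trans π-second (sym (insertCycle-second σ a p))
  ... | old i  = trans (π-old i) (sym (insertCycle-old σ a p i))

-- Enumerations and the double count of marked involutions

allVecs-unique : ∀ k ℓ → Unique (allVecs k ℓ)
allVecs-unique k zero    = All.[] AllPairs.∷ AllPairs.[]
allVecs-unique k (suc ℓ) =
  Unique.cartesianProductWith⁺ _∷_ ∷-injective (Unique.allFin⁺ k) (allVecs-unique k ℓ)

∈-allVecs : ∀ {k ℓ} (w : Vec (Fin k) ℓ) → w ∈ allVecs k ℓ
∈-allVecs []      = here refl
∈-allVecs (x ∷ w) = ∈-cartesianProductWith⁺ _∷_ (∈-allFin x) (∈-allVecs w)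

record Enumerates {a} {A : Set a} (P : A → Set) (xs : List A) : Set a where
  field
    unique   : Unique xs
    sound    : ∀ {x} → x ∈ xs → P x
    complete : ∀ {x} → P x → x ∈ xs

open Enumerates

module _ {a b} {A : Set a} {B : Set b} {P : A → Set} {Q : B → Set} {xs : List A} {ys : List B} where

  enumerates-× : Enumerates P xs → Enumerates Q ys →
    Enumerates (λ (x , y) → P x × Q y) (cartesianProduct xs ys)
  enumerates-× xs-P ys-Q .unique = Unique.cartesianProduct⁺ (xs-P .unique) (ys-Q .unique)
  enumerates-× xs-P ys-Q .sound xy∈ with x∈ , y∈ ← ∈-cartesianProduct⁻ xs ys xy∈ =
    xs-P .sound x∈ , ys-Q .sound y∈
  enumerates-× xs-P ys-Q .complete (px , qy) = ∈-cartesianProduct⁺ (xs-P .complete px) (ys-Q .complete qy)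

  -- Two lists without repetition that have the same members are permutations of each other; f
  -- carries one enumeration to the other.
  enumerates-↭ : Enumerates P xs → Enumerates Q ys → (f : A → B) → (∀ {x y} → f x ≡ f y → x ≡ y) →
    (∀ {x} → P x → Q (f x)) → (∀ {y} → Q y → ∃ λ x → P x × y ≡ f x) → ys ↭ List.map f xs
  enumerates-↭ xs-P ys-Q f f-inj to from =
    ∼bag⇒↭ (unique∧set⇒bag (ys-Q .unique) (Unique.map⁺ f-inj (xs-P .unique)) (mk⇔ ys⊆ ⊆ys))
    where
    ys⊆ : ∀ {y} → y ∈ ys → y ∈ List.map f xs
    ys⊆ y∈ with x , px , refl ← from (ys-Q .sound y∈) = ∈-map⁺ f (xs-P .complete px)
    ⊆ys : ∀ {y} → y ∈ List.map f xs → y ∈ ys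
    ⊆ys y∈ with x , x∈ , refl ← ∈-map⁻ f y∈ = ys-Q .complete (to (xs-P .sound x∈))

allFin-enumerates : ∀ n → Enumerates (λ _ → ⊤) (allFin n)
allFin-enumerates n .unique     = Unique.allFin⁺ n
allFin-enumerates n .sound _    = tt
allFin-enumerates n .complete _ = ∈-allFin _

fpfInvolutions-enumerates : ∀ m → Enumerates IsFPFInvolution (fpfInvolutions m)
fpfInvolutions-enumerates m .unique   = Unique.filter⁺ isFPFInvolution? (allVecs-unique m m)
fpfInvolutions-enumerates m .sound π∈ = proj₂ (∈-filter⁻ isFPFInvolution? {xs = allVecs m m} π∈)
fpfInvolutions-enumerates m .complete = ∈-filter⁺ isFPFInvolution? (∈-allVecs _)

marked-↭ : ∀ m → cartesianProduct (fpfInvolutions (suc (suc m))) (allFin (suc (suc m))) ↭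
  List.map insertMarked (cartesianProduct (fpfInvolutions m) (cartesianProduct (allFin (suc (suc m))) (allFin (suc m))))
marked-↭ m = enumerates-↭
  (enumerates-× (fpfInvolutions-enumerates m)
    (enumerates-× (allFin-enumerates (suc (suc m))) (allFin-enumerates (suc m))))
  (enumerates-× (fpfInvolutions-enumerates (suc (suc m))) (allFin-enumerates (suc (suc m))))
  insertMarked insertMarked-injective
  (λ { {σ , a , p} (σ-fpf , _) → insertCycle-isFPFInvolution σ a p σ-fpf , tt })
  (λ { {π , a} (π-fpf , _) → let σ , p , σ-fpf , eq = insertMarked-surjective π a π-fpf
                             in (σ , a , p) , (σ-fpf , tt , tt) , cong (_, a) eq })

-- The pairs (π, a) are counted in two ways: each π carries m + 2 marks a, and each marked π arises
-- from exactly one triple (σ, a, p).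
sumOver-insertCycle : ∀ {m} (f : Word (suc (suc m)) → ℤ) →
  + suc (suc m) * sumOver f (fpfInvolutions (suc (suc m))) ≡
    sumOver (λ σ → sum (λ a → sum (λ p → f (insertCycle σ a p)))) (fpfInvolutions m)
sumOver-insertCycle {m} f = begin
  + suc (suc m) * sumOver f Πs
    ≡⟨ sumOver-*ˡ f (+ suc (suc m)) Πs ⟨
  sumOver (λ π → + suc (suc m) * f π) Πs
    ≡⟨ sumOver-cong-∈ Πs (λ {π} _ →
         trans (sumOver-tabulate (λ _ → f π) {suc (suc m)} id) (sum-const (suc (suc m)) (f π))) ⟨
  sumOver (λ π → sumOver (λ _ → f π) (allFin (suc (suc m)))) Πs
    ≡⟨ sumOver-cartesianProduct (f ∘ proj₁) Πs (allFin (suc (suc m))) ⟨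
  sumOver (f ∘ proj₁) (cartesianProduct Πs (allFin (suc (suc m))))
    ≡⟨ sumOver-↭ (f ∘ proj₁) (marked-↭ m) ⟩
  sumOver (f ∘ proj₁) (List.map insertMarked (cartesianProduct (fpfInvolutions m) pairs))
    ≡⟨ sumOver-map (f ∘ proj₁) insertMarked (cartesianProduct (fpfInvolutions m) pairs) ⟩
  sumOver (f ∘ proj₁ ∘ insertMarked) (cartesianProduct (fpfInvolutions m) pairs)
    ≡⟨ sumOver-cartesianProduct (f ∘ proj₁ ∘ insertMarked) (fpfInvolutions m) pairs ⟩
  sumOver (λ σ → sumOver (λ (a , p) → f (insertCycle σ a p)) pairs) (fpfInvolutions m)
    ≡⟨ sumOver-cong-∈ (fpfInvolutions m) (λ {σ} _ → begin
         sumOver (λ (a , p) → f (insertCycle σ a p)) pairs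
           ≡⟨ sumOver-cartesianProduct (λ (a , p) → f (insertCycle σ a p)) (allFin (suc (suc m))) (allFin (suc m)) ⟩
         sumOver (λ a → sumOver (λ p → f (insertCycle σ a p)) (allFin (suc m))) (allFin (suc (suc m)))
           ≡⟨ sumOver-tabulate (λ a → sumOver (λ p → f (insertCycle σ a p)) (allFin (suc m))) id ⟩
         sum (λ a → sumOver (λ p → f (insertCycle σ a p)) (allFin (suc m)))
           ≡⟨ sum-cong-≗ (λ a → sumOver-tabulate (λ p → f (insertCycle σ a p)) id) ⟩
         sum (λ a → sum (λ p → f (insertCycle σ a p)))
           ∎) ⟩
  sumOver (λ σ → sum (λ a → sum (λ p → f (insertCycle σ a p)))) (fpfInvolutions m)
    ∎
  where
  open ≡-Reasoning
  Πs = fpfInvolutions (suc (suc m))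
  pairs = cartesianProduct (allFin (suc (suc m))) (allFin (suc m))

-- From descent indicators to the recurrence

χ : ℤ → ℤ → ℤ
χ j d = indicator (d ℤ.≟ j)

χ-shift : ∀ j d i → χ j (d + i) ≡ χ (j - i) d
χ-shift j d i with d + i ℤ.≟ j | d ℤ.≟ j - i
... | yes _   | yes _   = refl
... | no  _   | no  _   = refl
... | yes eq  | no  neq = contradiction (trans (cancel d i) (cong (_- i) eq)) neq
  where
  cancel : ∀ d i → d ≡ d + i - i
  cancel = solve-∀
... | no  neq | yes eq  = contradiction (trans (cong (_+ i) eq) (cancel j i)) neq
  where
  cancel : ∀ j i → j - i + i ≡ j
  cancel = solve-∀

-- Since `χ j` vanishes away from j, a coefficient depending on the descent number of σ may be
-- frozen at j and taken out of the sum over σ.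
*-χ : ∀ (c : ℤ → ℤ) j d → c d * χ j d ≡ c j * χ j d
*-χ c j d with d ℤ.≟ j
... | yes refl = refl
... | no  _    = trans (ℤ.*-zeroʳ (c d)) (sym (ℤ.*-zeroʳ (c j)))

-- Involutions with j descents arise from those with j, j - 1 and j - 2 descents, so each insertion
-- count is evaluated at the corresponding shifted argument.
J-recurrence : ∀ m j →
  + suc (suc m) * + J (suc (suc m)) j ≡
    (j * (j + 1ℤ) + + m) * + J m j
    + + 2 * ((j - 1ℤ) * (+ m - (j - 1ℤ)) + 1ℤ) * + J m (j - 1ℤ)
    + ((+ m - (j - + 2)) * (+ m - (j - + 2) + 1ℤ) + + m) * + J m (j - + 2)
J-recurrence m j = begin
  + suc (suc m) * + J (suc (suc m)) j
    ≡⟨ cong₂ _*_ (refl {x = + suc (suc m)}) (J≡ (suc (suc m)) j) ⟩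
  + suc (suc m) * sumOver (λ π → χ j (+ descents π)) (fpfInvolutions (suc (suc m)))
    ≡⟨ sumOver-insertCycle {m} (λ π → χ j (+ descents π)) ⟩
  sumOver (λ σ → sum (λ a → sum (λ p → χ j (+ descents (insertCycle σ a p))))) Σs
    ≡⟨ sumOver-cong-∈ Σs (λ {σ} σ∈ →
         trans (∑∑-insertCycle σ (fpfInvolutions-enumerates m .sound σ∈) (χ j)) (coefficients (+ descents σ))) ⟩
  sumOver (λ σ → c₀ j * χ j (+ descents σ) + c₁ (j - 1ℤ) * χ (j - 1ℤ) (+ descents σ)
                 + c₂ (j - + 2) * χ (j - + 2) (+ descents σ)) Σs
    ≡⟨ sumOver-linear (λ σ → χ j (+ descents σ)) (λ σ → χ (j - 1ℤ) (+ descents σ)) (λ σ → χ (j - + 2) (+ descents σ))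
         (c₀ j) (c₁ (j - 1ℤ)) (c₂ (j - + 2)) Σs ⟩
  c₀ j * sumOver (λ σ → χ j (+ descents σ)) Σs + c₁ (j - 1ℤ) * sumOver (λ σ → χ (j - 1ℤ) (+ descents σ)) Σs
    + c₂ (j - + 2) * sumOver (λ σ → χ (j - + 2) (+ descents σ)) Σs
    ≡⟨ cong₂ _+_ (cong₂ _+_ (cong₂ _*_ (refl {x = c₀ j}) (J≡ m j))
           (cong₂ _*_ (refl {x = c₁ (j - 1ℤ)}) (J≡ m (j - 1ℤ))))
         (cong₂ _*_ (refl {x = c₂ (j - + 2)}) (J≡ m (j - + 2))) ⟨
  c₀ j * + J m j + c₁ (j - 1ℤ) * + J m (j - 1ℤ) + c₂ (j - + 2) * + J m (j - + 2)
    ∎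
  where
  open ≡-Reasoning
  Σs = fpfInvolutions m
  c₀ c₁ c₂ : ℤ → ℤ
  c₀ d = d * (d + 1ℤ) + + m
  c₁ d = + 2 * (d * (+ m - d) + 1ℤ)
  c₂ d = (+ m - d) * (+ m - d + 1ℤ) + + m
  J≡ : ∀ m j → + J m j ≡ sumOver (λ π → χ j (+ descents π)) (fpfInvolutions m)
  J≡ m j = length-filter (λ π → + descents π ℤ.≟ j) (fpfInvolutions m)
  coefficients : ∀ d → c₀ d * χ j d + c₁ d * χ j (d + 1ℤ) + c₂ d * χ j (d + + 2) ≡
    c₀ j * χ j d + c₁ (j - 1ℤ) * χ (j - 1ℤ) d + c₂ (j - + 2) * χ (j - + 2) d
  coefficients d = cong₂ _+_
    (cong₂ _+_ (*-χ c₀ j d) (trans (cong₂ _*_ (refl {x = c₁ d}) (χ-shift j d 1ℤ)) (*-χ c₁ (j - 1ℤ) d)))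
    (trans (cong₂ _*_ (refl {x = c₂ d}) (χ-shift j d (+ 2))) (*-χ c₂ (j - + 2) d))

theorem2p1 : ∀ (n k : ℕ) → n ℕ.≥ 2 →
    + 2 * + n * + J (2 ℕ.* n) (+ k)
    ≡ (+ k * (+ k + + 1) + + 2 * + n - + 2) * + J (2 ℕ.* n ℕ.∸ 2) (+ k)
    + + 2 * ((+ k - + 1) * (+ 2 * + n - + k - + 1) + + 1) * + J (2 ℕ.* n ℕ.∸ 2) (+ k - + 1)
    + ((+ 2 * + n - + k) * (+ 2 * + n - + k + + 1) + + 2 * + n - + 2) * + J (2 ℕ.* n ℕ.∸ 2) (+ k - + 2)
theorem2p1 n@(suc (suc n′)) k (ℕ.s≤s (ℕ.s≤s _)) = begin
  + 2 * + n * + J (2 ℕ.* n) (+ k)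
    ≡⟨ cong (_* + J (2 ℕ.* n) (+ k)) (ℤ.pos-* 2 n) ⟨
  -- The pattern on `n` lets `2 ℕ.* n` compute to `suc (suc m)`.
  + suc (suc m) * + J (suc (suc m)) (+ k)
    ≡⟨ J-recurrence m (+ k) ⟩
  (+ k * (+ k + 1ℤ) + + m) * + J m (+ k)
    + + 2 * ((+ k - 1ℤ) * (+ m - (+ k - 1ℤ)) + 1ℤ) * + J m (+ k - 1ℤ)
    + ((+ m - (+ k - + 2)) * (+ m - (+ k - + 2) + 1ℤ) + + m) * + J m (+ k - + 2)
    ≡⟨ cong (λ z → (+ k * (+ k + 1ℤ) + z) * + J m (+ k)
         + + 2 * ((+ k - 1ℤ) * (z - (+ k - 1ℤ)) + 1ℤ) * + J m (+ k - 1ℤ)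
         + ((z - (+ k - + 2)) * (z - (+ k - + 2) + 1ℤ) + z) * + J m (+ k - + 2)) m≡ ⟩
  _ ≡⟨ normalise (+ 2 * + n) (+ k) (+ J m (+ k)) (+ J m (+ k - 1ℤ)) (+ J m (+ k - + 2)) ⟩
  (+ k * (+ k + + 1) + + 2 * + n - + 2) * + J m (+ k)
    + + 2 * ((+ k - + 1) * (+ 2 * + n - + k - + 1) + + 1) * + J m (+ k - + 1)
    + ((+ 2 * + n - + k) * (+ 2 * + n - + k + + 1) + + 2 * + n - + 2) * + J m (+ k - + 2)
    ∎
  where
  open ≡-Reasoning
  m = 2 ℕ.* n ℕ.∸ 2
  m≡ : + m ≡ + 2 * + n - + 2
  m≡ = trans (cancel (+ m)) (cong (_- + 2) (ℤ.pos-* 2 n))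
    where
    cancel : ∀ x → x ≡ + 2 + x - + 2
    cancel = solve-∀
  normalise : ∀ N k x y z →
    (k * (k + 1ℤ) + (N - + 2)) * x
      + + 2 * ((k - 1ℤ) * (N - + 2 - (k - 1ℤ)) + 1ℤ) * y
      + ((N - + 2 - (k - + 2)) * (N - + 2 - (k - + 2) + 1ℤ) + (N - + 2)) * z
    ≡ (k * (k + 1ℤ) + N - + 2) * x
      + + 2 * ((k - 1ℤ) * (N - k - 1ℤ) + 1ℤ) * y
      + ((N - k) * (N - k + 1ℤ) + N - + 2) * z
  normalise = solve-∀
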